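{- Let $n\ge 1$ be an integer and let $x$ be an integer with $0\le x\le n-1$ such that there exists a positive divisor $h$ of $x$ with $(2x+1)\mid(2n-2h+1)$. Then $F_{n,n-x}=1$.
   Context: Define maps $G,S:\mathbb Z^2\to\mathbb Z^2$ by $G(x,y)=(x+y,y)$ and $S(x,y)=(3x-2y+1,\,2x-y+1)$. Define the array $(F_{n,k})_{n,k\ge 0}$ by $F_{0,0}=1$ and, for $(n,k)\neq(0,0)$, $F_{n,k}$ is the number of finite words $w=w_1w_2\cdots w_m$ ($m\ge 0$) over the alphabet $\{G,S\}$ with $w_1\circ w_2\circ\cdots\circ w_m(1,1)=(n,k)$ (the empty word acts as the identity). Equivalently: start with all entries $0$, set $F_{0,0}=1$ and $F_{1,1}=1$, and thereafter, whenever an entry $F_{n,k}$ with $n\ge 1$ changes its value, increase $F_{n+k,k}$ and $F_{3n+1-2k,\,2n+1-k}$ by $1$. Every positive integer divides $0$. -}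

module Defs where

open import Axiom.UniquenessOfIdentityProofs using (module Decidable⇒UIP)
open import Data.Empty using (⊥-elim)
open import Data.Fin.Base using (Fin)
open import Data.Integer.Base using (ℤ; +_; _+_; _-_; _*_)
import Data.Integer.Properties as ℤ
open import Data.Integer.Tactic.RingSolver using (solve-∀)
open import Data.List.Base using (List; []; _∷_; _++_; map; filter; length; lookup)
open import Data.List.Membership.Propositional using (_∈_)
open import Data.List.Membership.Propositional.Properties
  using (∈-map⁺; ∈-map⁻; ∈-++⁺ˡ; ∈-++⁺ʳ; ∈-filter⁺; ∈-filter⁻; ∈-lookup)
open import Data.List.Properties using (∷-injectiveʳ)
open import Data.List.Relation.Unary.All as All using ([]; _∷_)
open import Data.List.Relation.Unary.AllPairs using ([]; _∷_)
open import Data.List.Relation.Unary.Any using (here; there; index)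
open import Data.List.Relation.Unary.Any.Properties using (lookup-index)
open import Data.List.Relation.Unary.Unique.Propositional using (Unique)
import Data.List.Relation.Unary.Unique.Propositional.Properties as Unique
open import Data.Nat.Base as ℕ using (ℕ; zero; suc; _≤_; z≤n; s≤s)
import Data.Nat.Properties as ℕ
open import Data.Product.Base using (_×_; _,_; ∃-syntax; proj₁; proj₂)
open import Data.Product.Properties using (≡-dec)
open import Function.Base using (id; _∘_)
open import Function.Bundles using (_↔_; mk↔ₛ′)
open import Relation.Binary.Definitions using (DecidableEquality)
open import Relation.Binary.PropositionalEquality
open import Relation.Nullary.Negation using (¬_)
open import Relation.Unary using (Decidable)

Point : Set
Point = ℤ × ℤ

_≟ᴾ_ : DecidableEquality Point
_≟ᴾ_ = ≡-dec ℤ._≟_ ℤ._≟_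

data Letter : Set where
  G S : Letter

Word : Set
Word = List Letter

⟦_⟧ˡ : Letter → Point → Point
⟦ G ⟧ˡ (x , y) = x + y , y
⟦ S ⟧ˡ (x , y) = + 3 * x - + 2 * y + + 1 , + 2 * x - y + + 1

⟦_⟧ : Word → Point → Point
⟦ []    ⟧ = id
⟦ l ∷ w ⟧ = ⟦ l ⟧ˡ ∘ ⟦ w ⟧

Reaches : ℕ → ℕ → Word → Set
Reaches n k w = ⟦ w ⟧ (+ 1 , + 1) ≡ (+ n , + k)

reaches? : ∀ n k → Decidable (Reaches n k)
reaches? n k w = ⟦ w ⟧ (+ 1 , + 1) ≟ᴾ (+ n , + k)

-- All words of length at most m, each exactly once.
words≤ : ℕ → List Word
words≤ zero    = [] ∷ []
words≤ (suc m) = [] ∷ map (G ∷_) (words≤ m) ++ map (S ∷_) (words≤ m)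

-- Every word reaching (n , k) has length at most n (`reaches⇒length≤` below),
-- so this list misses none of them.
reachingWords : ℕ → ℕ → List Word
reachingWords n k = filter (reaches? n k) (words≤ n)

F : ℕ → ℕ → ℕ
F zero zero = 1
F n    k    = length (reachingWords n k)

------------------------------------------------------------------------
-- The bounded search is exhaustive: away from the origin, F n k is the
-- cardinality of the set of all words reaching (n , k) (`F-counts`).

-- Orbit points have the form (1 + b + a , 1 + b) with a, b ≥ 0.
orbit : ∀ w → ∃[ a ] ∃[ b ]
        ⟦ w ⟧ (+ 1 , + 1) ≡ (+ (1 ℕ.+ b ℕ.+ a) , + (1 ℕ.+ b)) × length w ≤ b ℕ.+ a
orbit [] = 0 , 0 , refl , z≤n
orbit (G ∷ w) with a , b , eq , len ← orbit w =
  a ℕ.+ (1 ℕ.+ b) , b ,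
  trans (cong ⟦ G ⟧ˡ eq) (cong₂ _,_ (lemma (+ a) (+ b)) refl) ,
  (begin
    suc (length w)           ≤⟨ s≤s len ⟩
    suc (b ℕ.+ a)            ≡⟨ ℕ.+-suc b a ⟨
    b ℕ.+ suc a              ≤⟨ ℕ.+-monoʳ-≤ b (s≤s (ℕ.m≤m+n a b)) ⟩
    b ℕ.+ suc (a ℕ.+ b)      ≡⟨ cong (b ℕ.+_) (ℕ.+-suc a b) ⟨
    b ℕ.+ (a ℕ.+ suc b)      ∎)
  where
  open ℕ.≤-Reasoning
  lemma : ∀ a b → (+ 1 + b + a) + (+ 1 + b) ≡ + 1 + b + (a + (+ 1 + b))
  lemma = solve-∀
orbit (S ∷ w) with a , b , eq , len ← orbit w =
  a , 1 ℕ.+ b ℕ.+ (a ℕ.+ a) ,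
  trans (cong ⟦ S ⟧ˡ eq) (cong₂ _,_ (lemma₁ (+ a) (+ b)) (lemma₂ (+ a) (+ b))) ,
  s≤s (ℕ.≤-trans len (ℕ.+-monoˡ-≤ a (ℕ.m≤m+n b (a ℕ.+ a))))
  where
  lemma₁ : ∀ a b → + 3 * (+ 1 + b + a) - + 2 * (+ 1 + b) + + 1
                 ≡ + 1 + (+ 1 + b + (a + a)) + a
  lemma₁ = solve-∀
  lemma₂ : ∀ a b → + 2 * (+ 1 + b + a) - (+ 1 + b) + + 1
                 ≡ + 1 + (+ 1 + b + (a + a))
  lemma₂ = solve-∀

reaches⇒length≤ : ∀ {n k} w → Reaches n k w → length w ≤ n
reaches⇒length≤ {n} w r with a , b , eq , len ← orbit w =
  subst (length w ≤_) (ℤ.+-injective (cong proj₁ (trans (sym eq) r))) (ℕ.m≤n⇒m≤1+n len)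

∈-words≤ : ∀ {m} w → length w ≤ m → w ∈ words≤ m
∈-words≤ {zero}  []      _         = here refl
∈-words≤ {suc m} []      _         = here refl
∈-words≤ {suc m} (G ∷ w) (s≤s len) = there (∈-++⁺ˡ (∈-map⁺ (G ∷_) (∈-words≤ w len)))
∈-words≤ {suc m} (S ∷ w) (s≤s len) =
  there (∈-++⁺ʳ (map (G ∷_) (words≤ m)) (∈-map⁺ (S ∷_) (∈-words≤ w len)))

words≤-unique : ∀ m → Unique (words≤ m)
words≤-unique zero    = [] ∷ []
words≤-unique (suc m) =
  All.tabulate nonempty ∷
  Unique.++⁺ (Unique.map⁺ ∷-injectiveʳ ih) (Unique.map⁺ ∷-injectiveʳ ih) disjoint
  where
  ih = words≤-unique m

  disjoint : ∀ {w} → ¬ (w ∈ map (G ∷_) (words≤ m) × w ∈ map (S ∷_) (words≤ m))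
  disjoint (p , q) with ∈-map⁻ (G ∷_) p | ∈-map⁻ (S ∷_) q
  ... | _ , _ , refl | _ , _ , ()

  nonempty : ∀ {w} → w ∈ map (G ∷_) (words≤ m) ++ map (S ∷_) (words≤ m) → [] ≢ w
  nonempty p refl = go (words≤ m) p
    where
    go′ : ∀ ws → ¬ ([] ∈ map (S ∷_) ws)
    go′ (_ ∷ ws) (there q) = go′ ws q
    go : ∀ ws {vs} → ¬ ([] ∈ map (G ∷_) ws ++ map (S ∷_) vs)
    go []       {vs} q = go′ vs q
    go (_ ∷ ws) (there q) = go ws q

lookup-injective : ∀ {A : Set} {xs : List A} → Unique xs →
                   ∀ i j → lookup xs i ≡ lookup xs j → i ≡ j
lookup-injective (_  ∷ _) Fin.zero    Fin.zero    _  = refl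
lookup-injective (x∉ ∷ _) Fin.zero    (Fin.suc j) eq = ⊥-elim (All.lookup x∉ (∈-lookup j) eq)
lookup-injective (x∉ ∷ _) (Fin.suc i) Fin.zero    eq = ⊥-elim (All.lookup x∉ (∈-lookup i) (sym eq))
lookup-injective (_  ∷ u) (Fin.suc i) (Fin.suc j) eq = cong Fin.suc (lookup-injective u i j eq)

reachingWords-counts : ∀ n k → Fin (length (reachingWords n k)) ↔ (∃[ w ] Reaches n k w)
reachingWords-counts n k = mk↔ₛ′ to from to∘from from∘to
  where
  ws = reachingWords n k

  unique : Unique ws
  unique = Unique.filter⁺ (reaches? n k) (words≤-unique n)

  complete : ∀ w → Reaches n k w → w ∈ ws
  complete w r = ∈-filter⁺ (reaches? n k) (∈-words≤ w (reaches⇒length≤ w r)) r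

  to : Fin (length ws) → ∃[ w ] Reaches n k w
  to i = lookup ws i , proj₂ (∈-filter⁻ (reaches? n k) {xs = words≤ n} (∈-lookup i))

  from : (∃[ w ] Reaches n k w) → Fin (length ws)
  from (w , r) = index (complete w r)

  Σ-≡ : {p q : ∃[ w ] Reaches n k w} → proj₁ p ≡ proj₁ q → p ≡ q
  Σ-≡ {_ , r} {_ , s} refl = cong (_ ,_) (Decidable⇒UIP.≡-irrelevant _≟ᴾ_ r s)

  to∘from : ∀ p → to (from p) ≡ p
  to∘from (w , r) = Σ-≡ (sym (lookup-index (complete w r)))

  from∘to : ∀ i → from (to i) ≡ i
  from∘to i = lookup-injective unique (from (to i)) i (cong proj₁ (to∘from (to i)))

F-counts : ∀ n k → (n , k) ≢ (0 , 0) → Fin (F n k) ↔ (∃[ w ] Reaches n k w)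
F-counts zero    zero    ≢0 = ⊥-elim (≢0 refl)
F-counts zero    (suc k) _  = reachingWords-counts zero (suc k)
F-counts (suc n) k       _  = reachingWords-counts (suc n) k

{-# OPTIONS --safe #-}
-- In the coordinates (x , b) with (n , k) = (1 + b + x , 1 + b), the maps become
-- G (x , b) = (x + (1 + b) , b) and S (x , b) = (x , b + (1 + 2 x)), started at the
-- origin.  A point x > b can only come from G and a point b > 2 x only from S, so the
-- Euclid-like descent is deterministic and F n k ≤ 1.  If h divides x = q h and
-- k = h + t (2 x + 1), the word S ^ t G ^ q S ^ (h - 1) reaches (n , k).
module Submission where

open import Defs
open import Axiom.UniquenessOfIdentityProofs using (module Decidable⇒UIP)
open import Data.Fin.Base using (Fin; zero; suc)
open import Data.Integer.Base as ℤ using (ℤ; +_; -[1+_])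
open import Data.Integer.Divisibility as ℤ using ()
import Data.Integer.Divisibility.Signed as Signed
import Data.Integer.Properties as ℤ
open import Data.Integer.Tactic.RingSolver using (solve-∀)
open import Data.List.Base using ([]; _∷_; _++_; replicate)
open import Data.Nat.Base using (ℕ; zero; suc; _+_; _*_; _≤_; _<_; _∸_; s≤s)
open import Data.Nat.Divisibility using (_∣_; divides; ∣⇒≤)
import Data.Nat.Properties as ℕ
open import Data.Product.Base using (_×_; _,_; ∃-syntax; proj₁; proj₂)
open import Function.Bundles using (_↔_; Injection; Inverse)
open import Function.Properties.Inverse using (↔⇒↣)
open import Relation.Binary.PropositionalEquality
open import Relation.Nullary.Negation using (contradiction)

-- Both maps only add in these coordinates, so no signs occur and natural numbers suffice.
step : Letter → ℕ × ℕ → ℕ × ℕ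
step G (x , b) = suc b + x , b
step S (x , b) = x , suc (2 * x) + b

run : Word → ℕ × ℕ
run []      = 0 , 0
run (l ∷ w) = step l (run w)

embed : ℕ × ℕ → Point
embed (x , b) = + (suc b + x) , + suc b

embed-step : ∀ l p → ⟦ l ⟧ˡ (embed p) ≡ embed (step l p)
embed-step G (x , b) = cong₂ _,_ (eq (+ x) (+ b)) refl
  where
  eq : ∀ x b → (+ 1 ℤ.+ b ℤ.+ x) ℤ.+ (+ 1 ℤ.+ b) ≡ + 1 ℤ.+ b ℤ.+ (+ 1 ℤ.+ b ℤ.+ x)
  eq = solve-∀
embed-step S (x , b) = cong₂ _,_
  (trans (eq₁ (+ x) (+ b)) (cong (λ z → + 1 ℤ.+ (+ 1 ℤ.+ z ℤ.+ + b) ℤ.+ + x) 2x))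
  (trans (eq₂ (+ x) (+ b)) (cong (λ z → + 1 ℤ.+ (+ 1 ℤ.+ z ℤ.+ + b)) 2x))
  where
  2x : + 2 ℤ.* + x ≡ + (2 * x)
  2x = sym (ℤ.pos-* 2 x)
  eq₁ : ∀ x b → + 3 ℤ.* (+ 1 ℤ.+ b ℤ.+ x) ℤ.- + 2 ℤ.* (+ 1 ℤ.+ b) ℤ.+ + 1
              ≡ + 1 ℤ.+ (+ 1 ℤ.+ + 2 ℤ.* x ℤ.+ b) ℤ.+ x
  eq₁ = solve-∀
  eq₂ : ∀ x b → + 2 ℤ.* (+ 1 ℤ.+ b ℤ.+ x) ℤ.- (+ 1 ℤ.+ b) ℤ.+ + 1
              ≡ + 1 ℤ.+ (+ 1 ℤ.+ + 2 ℤ.* x ℤ.+ b)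
  eq₂ = solve-∀

embed-injective : ∀ {p q} → embed p ≡ embed q → p ≡ q
embed-injective {x , b} {y , c} eq
  with refl ← ℕ.suc-injective (ℤ.+-injective (cong proj₂ eq)) =
  cong (_, b) (ℕ.+-cancelˡ-≡ (suc b) x y (ℤ.+-injective (cong proj₁ eq)))

⟦⟧≡embed-run : ∀ w → ⟦ w ⟧ (+ 1 , + 1) ≡ embed (run w)
⟦⟧≡embed-run []      = refl
⟦⟧≡embed-run (l ∷ w) = trans (cong ⟦ l ⟧ˡ (⟦⟧≡embed-run w)) (embed-step l (run w))

step-injective : ∀ l {p q} → step l p ≡ step l q → p ≡ q
step-injective G {x , b} {y , c} eq with refl ← cong proj₂ eq =
  cong (_, b) (ℕ.+-cancelˡ-≡ (suc b) x y (cong proj₁ eq))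
step-injective S {x , b} {y , c} eq with refl ← cong proj₁ eq =
  cong (x ,_) (ℕ.+-cancelˡ-≡ (suc (2 * x)) b c (cong proj₂ eq))

-- An equality would give `b < y` from the first coordinates and `y < b` from the second.
step-disjoint : ∀ p q → step G p ≢ step S q
step-disjoint (x , b) (y , c) eq = ℕ.<-irrefl refl (begin-strict
  b                  <⟨ ℕ.m≤m+n (suc b) x ⟩
  suc b + x          ≡⟨ cong proj₁ eq ⟩
  y                  ≤⟨ ℕ.m≤m+n y (y + 0) ⟩
  2 * y              ≤⟨ ℕ.n≤1+n (2 * y) ⟩
  suc (2 * y)        ≤⟨ ℕ.m≤m+n (suc (2 * y)) c ⟩
  suc (2 * y) + c    ≡⟨ cong proj₂ eq ⟨
  b                  ∎)
  where open ℕ.≤-Reasoning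

step≢origin : ∀ l p → step l p ≢ (0 , 0)
step≢origin G p ()
step≢origin S p ()

-- The endpoint determines the outermost letter, and injectivity of that step allows peeling it off.
-- The empty word stands apart because no step lands on the origin.
run-injective : ∀ v w → run v ≡ run w → v ≡ w
run-injective []      []      eq = refl
run-injective []      (l ∷ w) eq = contradiction (sym eq) (step≢origin l (run w))
run-injective (l ∷ v) []      eq = contradiction eq (step≢origin l (run v))
run-injective (G ∷ v) (G ∷ w) eq = cong (G ∷_) (run-injective v w (step-injective G eq))
run-injective (G ∷ v) (S ∷ w) eq = contradiction eq (step-disjoint (run v) (run w))
run-injective (S ∷ v) (G ∷ w) eq = contradiction (sym eq) (step-disjoint (run w) (run v))
run-injective (S ∷ v) (S ∷ w) eq = cong (S ∷_) (run-injective v w (step-injective S eq))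

reaches-unique : ∀ {n k} (p q : ∃[ w ] Reaches n k w) → p ≡ q
reaches-unique (v , r) (w , s)
  with refl ← run-injective v w (embed-injective
         (trans (sym (⟦⟧≡embed-run v)) (trans (trans r (sym s)) (⟦⟧≡embed-run w)))) =
  cong (v ,_) (Decidable⇒UIP.≡-irrelevant _≟ᴾ_ r s)

Fin↔contractible⇒≡1 : ∀ {m} {A : Set} → Fin m ↔ A → A → (∀ (x y : A) → x ≡ y) → m ≡ 1
Fin↔contractible⇒≡1 {zero}        f x prop with () ← Inverse.from f x
Fin↔contractible⇒≡1 {suc zero}    f x prop = refl
Fin↔contractible⇒≡1 {suc (suc m)} f x prop
  -- Two distinct indices would have equal images.
  with () ← Injection.injective (↔⇒↣ f) {zero} {suc zero} (prop _ _)

run⇒F≡1 : ∀ {x b} w → run w ≡ (x , b) → F (suc b + x) (suc b) ≡ 1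
run⇒F≡1 {x} {b} w eq = Fin↔contractible⇒≡1
  (F-counts (suc b + x) (suc b) (λ ()))
  (w , trans (⟦⟧≡embed-run w) (cong embed eq))
  reaches-unique

-- `G` leaves `b` fixed, so every repetition adds the same `suc b`; dually, `S` leaves `x` fixed in
-- `run-S^`.
run-G^ : ∀ t {x b} w → run w ≡ (x , b) → run (replicate t G ++ w) ≡ (t * suc b + x , b)
run-G^ zero            w eq = eq
run-G^ (suc t) {x} {b} w eq rewrite run-G^ t w eq =
  cong (_, b) (sym (ℕ.+-assoc (suc b) (t * suc b) x))

run-S^ : ∀ t {x b} w → run w ≡ (x , b) →
         run (replicate t S ++ w) ≡ (x , t * suc (2 * x) + b)
run-S^ zero            w eq = eq
run-S^ (suc t) {x} {b} w eq rewrite run-S^ t w eq =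
  cong (x ,_) (sym (ℕ.+-assoc (suc (2 * x)) (t * suc (2 * x)) b))

reachable-S^ : ∀ b → ∃[ w ] run w ≡ (0 , b)
reachable-S^ b = replicate b S ++ [] , trans (run-S^ b [] refl)
  (cong (0 ,_) (trans (ℕ.+-identityʳ (b * 1)) (ℕ.*-identityʳ b)))

-- At height `h` each `G` adds exactly the divisor `suc h`, so `q` of them take the first coordinate
-- from 0 to `x`.
reachable : ∀ {x h} → suc h ∣ x → ∀ t → ∃[ w ] run w ≡ (x , t * suc (2 * x) + h)
reachable {x} {h} (divides q eq) t with v , v↦ ← reachable-S^ h =
  replicate t S ++ replicate q G ++ v ,
  run-S^ t (replicate q G ++ v) (trans (run-G^ q v v↦)
        (cong (_, h) (trans (ℕ.+-identityʳ (q * suc h)) (sym eq))))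

-- Since 2 (k − h) is a multiple of 2 x + 1, so is k − h = (2 x + 1) (k − h) − x · 2 (k − h).
residue : ∀ k x h →
          (+ 2 ℤ.* + x ℤ.+ + 1) ℤ.∣ (+ 2 ℤ.* + (k + x) ℤ.- + 2 ℤ.* + h ℤ.+ + 1) →
          ∃[ t ] + k ≡ t ℤ.* + suc (2 * x) ℤ.+ + h
residue k x h d with Signed.divides q eq ← Signed.∣ᵤ⇒∣ d =
  t , (begin
    + k                                               ≡⟨ combine (+ k) (+ x) (+ h) ⟩
    (+ k ℤ.- + h ℤ.+ + x) ℤ.* m ℤ.- + x ℤ.* (+ 2 ℤ.* + (k + x) ℤ.- + 2 ℤ.* + h ℤ.+ + 1) ℤ.+ + h
      ≡⟨ cong (λ z → (+ k ℤ.- + h ℤ.+ + x) ℤ.* m ℤ.- + x ℤ.* z ℤ.+ + h) eq ⟩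
    (+ k ℤ.- + h ℤ.+ + x) ℤ.* m ℤ.- + x ℤ.* (q ℤ.* m) ℤ.+ + h
      ≡⟨ factor (+ k ℤ.- + h ℤ.+ + x) m (+ x) q (+ h) ⟩
    t ℤ.* m ℤ.+ + h
      ≡⟨ cong (λ z → t ℤ.* z ℤ.+ + h) m≡ ⟩
    t ℤ.* + suc (2 * x) ℤ.+ + h                       ∎)
  where
  open ≡-Reasoning
  m = + 2 ℤ.* + x ℤ.+ + 1
  t = + k ℤ.- + h ℤ.+ + x ℤ.- + x ℤ.* q
  m≡ : m ≡ + suc (2 * x)
  m≡ = trans (ℤ.+-comm (+ 2 ℤ.* + x) (+ 1)) (cong (λ z → + 1 ℤ.+ z) (sym (ℤ.pos-* 2 x)))
  combine : ∀ k x h → k ≡ (k ℤ.- h ℤ.+ x) ℤ.* (+ 2 ℤ.* x ℤ.+ + 1)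
                          ℤ.- x ℤ.* (+ 2 ℤ.* (k ℤ.+ x) ℤ.- + 2 ℤ.* h ℤ.+ + 1) ℤ.+ h
  combine = solve-∀
  factor : ∀ c m x q h → c ℤ.* m ℤ.- x ℤ.* (q ℤ.* m) ℤ.+ h ≡ (c ℤ.- x ℤ.* q) ℤ.* m ℤ.+ h
  factor = solve-∀

-- A negative quotient `- (1 + s)` would give `h = (1 + s) m + k ≥ m`, against `h < m`.
residue-pos : ∀ k m {h} → h < m → (t : ℤ) → + k ≡ t ℤ.* + m ℤ.+ + h →
              ∃[ s ] k ≡ s * m + h
residue-pos k m {h} h<m (+ s) eq =
  s , ℤ.+-injective (trans eq (cong (ℤ._+ + h) (sym (ℤ.pos-* s m))))
residue-pos k m {h} h<m -[1+ s ] eq = contradiction h<m (ℕ.≤⇒≯ (begin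
  m                  ≤⟨ ℕ.m≤m+n m (s * m) ⟩
  suc s * m          ≤⟨ ℕ.m≤m+n (suc s * m) k ⟩
  suc s * m + k      ≡⟨ ℤ.+-injective moved ⟩
  h                  ∎))
  where
  open ℕ.≤-Reasoning
  cancel : ∀ a m h → a ℤ.* m ℤ.+ (ℤ.- a ℤ.* m ℤ.+ h) ≡ h
  cancel = solve-∀
  moved : + (suc s * m + k) ≡ + h
  moved = trans (cong₂ ℤ._+_ (ℤ.pos-* (suc s) m) eq) (cancel (+ suc s) (+ m) (+ h))

divisor⇒reachable : ∀ x b {h} → suc h ∣ x →
  (+ 2 ℤ.* + x ℤ.+ + 1) ℤ.∣ (+ 2 ℤ.* + (suc b + x) ℤ.- + 2 ℤ.* + suc h ℤ.+ + 1) →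
  ∃[ w ] run w ≡ (x , b)
-- Here h may exceed k, as every positive integer divides 0.
divisor⇒reachable zero    b       h∣x d = reachable-S^ b
divisor⇒reachable (suc y) b {h} h∣x d
  with t , eq  ← residue (suc b) (suc y) (suc h) d
  -- As `x = suc y` is nonzero, its divisor `suc h` is at most `x`, hence below the modulus
  -- `2 x + 1`.
  with s , eq′ ← residue-pos (suc b) (suc (2 * suc y))
                   (s≤s (ℕ.≤-trans (∣⇒≤ h∣x) (ℕ.m≤m+n (suc y) _))) t eq
  with w , w↦ ← reachable h∣x s =
  w , trans w↦ (cong (suc y ,_)
        (sym (ℕ.suc-injective (trans eq′ (ℕ.+-suc (s * suc (2 * suc y)) h)))))

theorem9 : ∀ (n x : ℕ) → 1 ≤ n → x ≤ n ∸ 1 →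
    (∃[ h ] (1 ≤ h × h ∣ x × (+ 2 ℤ.* + x ℤ.+ + 1) ℤ.∣ (+ 2 ℤ.* + n ℤ.- + 2 ℤ.* + h ℤ.+ + 1))) →
    F n (n ∸ x) ≡ 1
theorem9 (suc n) x _ x≤n (suc h , _ , h∣x , d) with n ∸ x | ℕ.m∸n+n≡m x≤n
-- Matching `refl` replaces `n` by `b + x`, so the column index, `suc (b + x) ∸ x`, simplifies to
-- `suc b`.
... | b | refl
  with w , w↦ ← divisor⇒reachable x b h∣x d
  rewrite ℕ.m+n∸n≡m (suc b) x = run⇒F≡1 w w↦
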